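{- Let $U$ be a nonempty open convex cone in $E=\mathbb{R}^n$. Let $\phi:E\to\mathbb{R}$ be a continuous function which is differentiable on $U$, and let $F=d\phi:U\to E^*$ be its differential. Let $$C_1=\{u'\in E^*:\ (\forall u\in U)\ (u,u')\ge\phi(u)\}$$ and let $C_1^o$ be the interior of $C_1$. Assume: (1) $\phi$ is concave on $U$; (2) $\phi$ is positively 1-homogeneous; (3) $\phi>0$ on $U$, and $\phi=0$ on $E\setminus U$. Then $$C_1^o\subset\mathbb{R}^{\ge1}F(U)\subset C_1 .$$
   Context: $E^*$ is the dual space of $E$ and $(u,u')$ is the natural pairing of $E$ with $E^*$. $\phi$ is positively 1-homogeneous if $\phi(\alpha x)=\alpha\phi(x)$ for all real $\alpha>0$. For a set $W$, $\mathbb{R}^{\ge1}W=\{rw:\ r\in\mathbb{R},\ r\ge1,\ w\in W\}$. -}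

module Defs where

open import Algebra.Bundles using (CommutativeRing)
open import Algebra.Definitions using (Invertible)
open import Algebra.Module.Bundles.Raw using (RawLeftModule)
open import Algebra.Module.Construct.TensorUnit using () renaming (rawLeftModule to self)
open import Algebra.Module.Morphism.Structures using (module LeftModuleMorphisms)
open import Data.Nat.Base using (ℕ)
open import Data.Product.Base using (Σ; ∃-syntax; Σ-syntax; _×_; proj₁)
open import Data.Vec.Functional using (Vector; foldr; map; zipWith; replicate)
open import Data.Vec.Functional.Relation.Binary.Pointwise using (Pointwise)
open import Level using (0ℓ; suc)
open import Relation.Binary.Bundles using (TotalOrder)
open import Relation.Binary.Core using (Rel)
open import Relation.Binary.Structures using (IsTotalOrder)
open import Relation.Unary using (Pred; _∈_; Satisfiable)
import Algebra.Construct.NaturalChoice.Max as Max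
import Relation.Binary.Construct.NonStrictToStrict as Strict

-- The real numbers, characterised up to isomorphism as a Dedekind-complete
-- ordered field.  Equality is a setoid equality, so that the usual
-- constructions by cuts or by Cauchy sequences qualify without quotients.
-- The field and order axioms are the classical ones: the structure is meant
-- to be used together with excluded middle.
record Reals : Set (suc 0ℓ) where
  infix 4 _≤_
  field
    commutativeRing : CommutativeRing 0ℓ 0ℓ

  open CommutativeRing commutativeRing public

  field
    0≉1          : 0# ≉ 1#
    invertible   : ∀ {x} → x ≉ 0# → Invertible _≈_ 1# _*_ x
    _≤_          : Rel Carrier 0ℓ
    isTotalOrder : IsTotalOrder _≈_ _≤_
    +-monoʳ-≤    : ∀ z {x y} → x ≤ y → z + x ≤ z + y
    *-nonNeg     : ∀ {x y} → 0# ≤ x → 0# ≤ y → 0# ≤ x * y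

  UpperBound : Pred Carrier 0ℓ → Pred Carrier 0ℓ
  UpperBound P b = ∀ {x} → x ∈ P → x ≤ b

  LeastUpperBound : Pred Carrier 0ℓ → Pred Carrier 0ℓ
  LeastUpperBound P s = s ∈ UpperBound P × (∀ {b} → b ∈ UpperBound P → s ≤ b)

  field
    complete : (P : Pred Carrier 0ℓ) → Satisfiable P →
               Satisfiable (UpperBound P) → Satisfiable (LeastUpperBound P)

  open Strict _≈_ _≤_ public using (_<_)

  totalOrder : TotalOrder 0ℓ 0ℓ 0ℓ
  totalOrder = record { isTotalOrder = isTotalOrder }

  open Max totalOrder public using (_⊔_)

  ∣_∣ : Carrier → Carrier
  ∣ x ∣ = x ⊔ (- x)

module Euclidean (ℝ : Reals) (n : ℕ) where

  open Reals ℝ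

  rawLeftModule : RawLeftModule Carrier 0ℓ 0ℓ
  rawLeftModule = record
    { Carrierᴹ = Vector Carrier n
    ; _≈ᴹ_     = Pointwise _≈_
    ; _+ᴹ_     = zipWith _+_
    ; _*ₗ_     = λ r → map (r *_)
    ; 0ᴹ       = replicate n 0#
    ; -ᴹ_      = map (-_)
    }

  open RawLeftModule rawLeftModule public
    using (_+ᴹ_; _*ₗ_; -ᴹ_) renaming (Carrierᴹ to E)

  infixl 6 _-ᴹ_
  _-ᴹ_ : E → E → E
  x -ᴹ y = x +ᴹ (-ᴹ y)

  -- The supremum norm; it induces the usual topology and the usual notion of
  -- differential on ℝⁿ, as does every other norm.
  ‖_‖ : E → Carrier
  ‖ x ‖ = foldr _⊔_ 0# (map ∣_∣ x)

  open LeftModuleMorphisms rawLeftModule (self {R = rawRing})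
    using (IsLeftModuleHomomorphism)

  E* : Set
  E* = Σ (E → Carrier) IsLeftModuleHomomorphism

  ⟨_,_⟩ : E → E* → Carrier
  ⟨ x , v' ⟩ = proj₁ v' x

  infix 4 _≈*_
  _≈*_ : Rel E* 0ℓ
  v' ≈* w' = ∀ x → ⟨ x , v' ⟩ ≈ ⟨ x , w' ⟩

  -- The operator norm of v' - w' is at most δ.
  Within : Carrier → Rel E* 0ℓ
  Within δ v' w' = ∀ x → ∣ ⟨ x , v' ⟩ - ⟨ x , w' ⟩ ∣ ≤ δ * ‖ x ‖

  Interior* : Pred E* 0ℓ → Pred E* 0ℓ
  Interior* S u' = ∃[ δ ] 0# < δ × (∀ v' → Within δ v' u' → v' ∈ S)

  -- { r w' : r ≥ 1, w' ∈ W }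
  ℝ≥1_ : Pred E* 0ℓ → Pred E* 0ℓ
  (ℝ≥1 W) v' =
    ∃[ r ] ∃[ w' ] 1# ≤ r × w' ∈ W × (∀ x → ⟨ x , v' ⟩ ≈ r * ⟨ x , w' ⟩)

  Open : Pred E 0ℓ → Set
  Open U = ∀ {x} → x ∈ U → ∃[ δ ] 0# < δ × (∀ y → ‖ y -ᴹ x ‖ < δ → y ∈ U)

  Convex : Pred E 0ℓ → Set
  Convex U = ∀ {x y} → x ∈ U → y ∈ U → ∀ t → 0# ≤ t → t ≤ 1# →
             ((1# - t) *ₗ x +ᴹ t *ₗ y) ∈ U

  Cone : Pred E 0ℓ → Set
  Cone U = ∀ {x} → x ∈ U → ∀ α → 0# < α → (α *ₗ x) ∈ U

  Continuous : (E → Carrier) → Set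
  Continuous φ = ∀ x ε → 0# < ε →
    ∃[ δ ] 0# < δ × (∀ y → ‖ y -ᴹ x ‖ < δ → ∣ φ y - φ x ∣ < ε)

  IsDifferentialAt : (E → Carrier) → E → E* → Set
  IsDifferentialAt φ u u' = ∀ ε → 0# < ε →
    ∃[ δ ] 0# < δ × (∀ h → ‖ h ‖ < δ →
      ∣ φ (u +ᴹ h) - φ u - ⟨ h , u' ⟩ ∣ ≤ ε * ‖ h ‖)

  -- φ is differentiable at every point of U, and F is its differential there.
  IsDifferentialOn : (U : Pred E 0ℓ) → (E → Carrier) → (∀ u → u ∈ U → E*) → Set
  IsDifferentialOn U φ F = ∀ u (u∈U : u ∈ U) → IsDifferentialAt φ u (F u u∈U)

  Image : (U : Pred E 0ℓ) → (∀ u → u ∈ U → E*) → Pred E* 0ℓ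
  Image U F w' = ∃[ u ] Σ[ u∈U ∈ u ∈ U ] w' ≈* F u u∈U

  ConcaveOn : Pred E 0ℓ → (E → Carrier) → Set
  ConcaveOn U φ = ∀ {x y} → x ∈ U → y ∈ U → ∀ t → 0# ≤ t → t ≤ 1# →
    (1# - t) * φ x + t * φ y ≤ φ ((1# - t) *ₗ x +ᴹ t *ₗ y)

  PositivelyHomogeneous : (E → Carrier) → Set
  PositivelyHomogeneous φ = ∀ α → 0# < α → ∀ x → φ (α *ₗ x) ≈ α * φ x

  C₁ : Pred E 0ℓ → (E → Carrier) → Pred E* 0ℓ
  C₁ U φ u' = ∀ u → u ∈ U → φ u ≤ ⟨ u , u' ⟩

{-# OPTIONS --safe #-}
module Submission where

-- C₁ ⊇ ℝ≥1 F(U): concavity and homogeneity make φ superadditive, so that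
-- φ (u - t v) + t φ v ≤ φ u; differentiating at t = 0 gives φ v ≤ (v, F u).
--
-- C₁ᵒ ⊆ ℝ≥1 F(U): if C₁ contains a δ-ball about u', then u' ± δ eᵢ* ∈ C₁, so
-- δ ∣uᵢ∣ ≤ (u, u') on U and the slice (u, u') ≤ 1 of U lies in a box.  By
-- compactness φ attains a maximum M > 0 on the slice (x, u') ≤ 1 of that box;
-- the maximiser x lies in U because φ vanishes elsewhere, and M ≤ 1 because
-- u' ∈ C₁.  By homogeneity φ ≤ M u' on U, while φ x ≥ M (x, u'), so F x = M u'
-- and u' = M⁻¹ F x.

open import Defs
open import Algebra.Bundles using (CommutativeRing)
open import Algebra.Module.Construct.TensorUnit using () renaming (rawLeftModule to self)
open import Algebra.Module.Morphism.Structures using (module LeftModuleMorphisms)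
open import Algebra.Solver.Ring.AlmostCommutativeRing using (fromCommutativeRing; _-Raw-AlmostCommutative⟶_)
open import Axiom.ExcludedMiddle using (ExcludedMiddle)
open import Data.Fin.Base using (Fin; zero; suc)
open import Data.Integer.Base as ℤ using (ℤ; +_; -[1+_]; _⊖_)
open import Data.Nat.Base as ℕ using (ℕ; zero; suc)
open import Data.Product.Base using (_×_; _,_; proj₁; proj₂; ∃-syntax)
open import Data.Sum.Base using (inj₁; inj₂; [_,_]′)
open import Data.Vec.Functional using (Vector; head; tail; _∷_)
open import Level using (0ℓ)
open import Relation.Binary.Bundles using (TotalOrder)
open import Relation.Binary.Definitions using (WeaklyDecidable)
open import Relation.Nullary using (¬_; Dec; yes; no; contradiction)
open import Relation.Nullary.Decidable.Core using (decidable-stable; dec⇒maybe)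
open import Relation.Unary using (Pred; _∈_; _∉_; _⊆_; _∪_; _∩_; Satisfiable)
import Algebra.Construct.NaturalChoice.Max as Max
import Algebra.Properties.AbelianGroup as AbelianGroupProperties
import Algebra.Properties.Ring as RingProperties
import Algebra.Properties.Semiring.Mult.TCOptimised as Multiples
import Algebra.Solver.Ring as RingSolver
import Data.Integer.Properties as ℤ
import Data.Maybe.Base as Maybe
import Data.Nat.Properties as ℕ
import Relation.Binary.PropositionalEquality.Core as ≡
import Relation.Binary.Reasoning.PartialOrder as PartialOrderReasoning
import Relation.Binary.Reasoning.Setoid as SetoidReasoning

-- Ring identities.

-- Integer coefficients let the solver cancel terms although equality in the
-- ring is undecidable.
module IntegerSolver (R : CommutativeRing 0ℓ 0ℓ) where

  open CommutativeRing R
  open RingProperties ring using (-‿distribˡ-*; -‿distribʳ-*)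
  open AbelianGroupProperties +-abelianGroup using (⁻¹-∙-comm; ⁻¹-involutive; ε⁻¹≈ε)
  open Multiples semiring using (1+×; ×-homo-+; ×1-homo-*) renaming (_×_ to _·_)
  open SetoidReasoning setoid

  -- These multiples satisfy `1 · 1# = 1#` by reduction, so the constants 0 and 1 of a solver
  -- equation are literally `0#` and `1#`.
  ⟦_⟧ : ℤ → Carrier
  ⟦ + n ⟧      = n · 1#
  ⟦ -[1+ n ] ⟧ = - (suc n · 1#)

  ⟦⟧-neg : ∀ n → ⟦ ℤ.- (+ n) ⟧ ≈ - (n · 1#)
  ⟦⟧-neg zero    = sym ε⁻¹≈ε
  ⟦⟧-neg (suc n) = refl

  -‿homo : ∀ i → ⟦ ℤ.- i ⟧ ≈ - ⟦ i ⟧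
  -‿homo (+ n)      = ⟦⟧-neg n
  -‿homo (-[1+ n ]) = sym (⁻¹-involutive _)

  -- Induction strips a successor from both arguments; inserting `1# - 1#` and regrouping restores
  -- them.
  ⊖-homo : ∀ m n → ⟦ m ⊖ n ⟧ ≈ m · 1# - n · 1#
  ⊖-homo m zero = sym (trans (+-congˡ ε⁻¹≈ε) (+-identityʳ _))
  ⊖-homo zero (suc n) = sym (+-identityˡ _)
  ⊖-homo (suc m) (suc n) = begin
    ⟦ suc m ⊖ suc n ⟧                    ≡⟨ ≡.cong ⟦_⟧ (ℤ.[1+m]⊖[1+n]≡m⊖n m n) ⟩
    ⟦ m ⊖ n ⟧                            ≈⟨ ⊖-homo m n ⟩
    m · 1# - n · 1#                      ≈⟨ +-congʳ (+-identityʳ _) ⟨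
    m · 1# + 0# - n · 1#                 ≈⟨ +-congʳ (+-congˡ (-‿inverseʳ 1#)) ⟨
    m · 1# + (1# - 1#) - n · 1#          ≈⟨ +-congʳ (+-assoc _ _ _) ⟨
    m · 1# + 1# - 1# - n · 1#            ≈⟨ +-assoc _ _ _ ⟩
    m · 1# + 1# + (- 1# - n · 1#)        ≈⟨ +-cong (+-comm _ _) (⁻¹-∙-comm _ _) ⟩
    1# + m · 1# - (1# + n · 1#)          ≈⟨ +-cong (1+× m 1#) (-‿cong (1+× n 1#)) ⟨
    suc m · 1# - suc n · 1#              ∎

  +-homo : ∀ i j → ⟦ i ℤ.+ j ⟧ ≈ ⟦ i ⟧ + ⟦ j ⟧
  +-homo (+ m)      (+ n)      = ×-homo-+ 1# m n
  +-homo (+ m)      (-[1+ n ]) = ⊖-homo m (suc n)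
  +-homo (-[1+ m ]) (+ n)      = trans (⊖-homo n (suc m)) (+-comm _ _)
  +-homo (-[1+ m ]) (-[1+ n ]) = begin
    - (suc (suc (m ℕ.+ n)) · 1#)       ≡⟨ ≡.cong (λ k → - (k · 1#)) (≡.cong suc (ℕ.+-suc m n)) ⟨
    - ((suc m ℕ.+ suc n) · 1#)         ≈⟨ -‿cong (×-homo-+ 1# (suc m) (suc n)) ⟩
    - (suc m · 1# + suc n · 1#)        ≈⟨ ⁻¹-∙-comm _ _ ⟨
    - (suc m · 1#) - suc n · 1#        ∎

  neg-* : ∀ m n → ⟦ ℤ.- (+ (m ℕ.* n)) ⟧ ≈ - ((m · 1#) * (n · 1#))
  neg-* m n = trans (⟦⟧-neg (m ℕ.* n)) (-‿cong (×1-homo-* m n))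

  *-homo : ∀ i j → ⟦ i ℤ.* j ⟧ ≈ ⟦ i ⟧ * ⟦ j ⟧
  *-homo (+ m)      (+ n)      = begin
    ⟦ (+ m) ℤ.* (+ n) ⟧  ≡⟨ ≡.cong ⟦_⟧ (ℤ.+◃n≡+n (m ℕ.* n)) ⟩
    (m ℕ.* n) · 1#       ≈⟨ ×1-homo-* m n ⟩
    (m · 1#) * (n · 1#)  ∎
  *-homo (+ m)      (-[1+ n ]) = begin
    ⟦ (+ m) ℤ.* -[1+ n ] ⟧        ≡⟨ ≡.cong ⟦_⟧ (ℤ.-◃n≡-n (m ℕ.* suc n)) ⟩
    ⟦ ℤ.- (+ (m ℕ.* suc n)) ⟧     ≈⟨ neg-* m (suc n) ⟩
    - ((m · 1#) * (suc n · 1#))   ≈⟨ -‿distribʳ-* _ _ ⟩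
    (m · 1#) * - (suc n · 1#)     ∎
  *-homo (-[1+ m ]) (+ n)      = begin
    ⟦ -[1+ m ] ℤ.* (+ n) ⟧        ≡⟨ ≡.cong ⟦_⟧ (ℤ.-◃n≡-n (suc m ℕ.* n)) ⟩
    ⟦ ℤ.- (+ (suc m ℕ.* n)) ⟧     ≈⟨ neg-* (suc m) n ⟩
    - ((suc m · 1#) * (n · 1#))   ≈⟨ -‿distribˡ-* _ _ ⟩
    - (suc m · 1#) * (n · 1#)     ∎
  *-homo (-[1+ m ]) (-[1+ n ]) = begin
    (suc m ℕ.* suc n) · 1#            ≈⟨ ×1-homo-* (suc m) (suc n) ⟩
    (suc m · 1#) * (suc n · 1#)       ≈⟨ ⁻¹-involutive _ ⟨
    - - ((suc m · 1#) * (suc n · 1#)) ≈⟨ -‿cong (-‿distribˡ-* _ _) ⟩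
    - (- (suc m · 1#) * (suc n · 1#)) ≈⟨ -‿distribʳ-* _ _ ⟩
    - (suc m · 1#) * - (suc n · 1#)   ∎

  morphism : ℤ.+-*-rawRing -Raw-AlmostCommutative⟶ fromCommutativeRing R
  morphism = record
    { ⟦_⟧ = ⟦_⟧ ; +-homo = +-homo ; *-homo = *-homo
    ; -‿homo = -‿homo ; 0-homo = refl ; 1-homo = refl }

  ≈-weaklyDecidable : WeaklyDecidable (λ i j → ⟦ i ⟧ ≈ ⟦ j ⟧)
  ≈-weaklyDecidable i j = Maybe.map (λ i≡j → reflexive (≡.cong ⟦_⟧ i≡j)) (dec⇒maybe (i ℤ.≟ j))

  open RingSolver ℤ.+-*-rawRing (fromCommutativeRing R) morphism ≈-weaklyDecidable public
    using (Polynomial; solve; con; _:+_; _:*_; _:-_; :-_; _:=_)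

-- Ordered-field arithmetic and induction along an interval.

module OrderedField (em : ExcludedMiddle 0ℓ) (ℝ : Reals) where

  open Reals ℝ
  open IntegerSolver commutativeRing
  open TotalOrder totalOrder public using (poset)
    renaming (refl to ≤-refl; trans to ≤-trans; antisym to ≤-antisym;
              total to ≤-total; reflexive to ≤-reflexive)
  open Max totalOrder public using (⊔-lub; x≤x⊔y; x≤y⊔x)
  module ≤-Reasoning = PartialOrderReasoning poset

  private variable d t x y z : Carrier

  :0 :1 : ∀ {n} → Polynomial n
  :0 = con (+ 0)
  :1 = con (+ 1)

  <⇒≤ : x < y → x ≤ y
  <⇒≤ = proj₁

  <⇒≱ : x < y → ¬ y ≤ x
  <⇒≱ (x≤y , x≉y) y≤x = x≉y (≤-antisym x≤y y≤x)

  ≰⇒> : ¬ x ≤ y → y < x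
  ≰⇒> {x} {y} x≰y with ≤-total x y
  ... | inj₁ x≤y = contradiction x≤y x≰y
  ... | inj₂ y≤x = y≤x , λ y≈x → x≰y (≤-reflexive (sym y≈x))

  ≮⇒≥ : ¬ x < y → y ≤ x
  ≮⇒≥ x≮y = decidable-stable em λ y≰x → x≮y (≰⇒> y≰x)

  <-≤-trans : x < y → y ≤ z → x < z
  <-≤-trans x<y y≤z = ≰⇒> λ z≤x → <⇒≱ x<y (≤-trans y≤z z≤x)

  ≤-<-trans : x ≤ y → y < z → x < z
  ≤-<-trans x≤y y<z = ≰⇒> λ z≤x → <⇒≱ y<z (≤-trans z≤x x≤y)

  ≤-gap : x ≤ y → 0# ≤ y - x
  ≤-gap {x} {y} x≤y = begin
    0#       ≈⟨ -‿inverseˡ x ⟨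
    - x + x  ≤⟨ +-monoʳ-≤ (- x) x≤y ⟩
    - x + y  ≈⟨ +-comm _ _ ⟩
    y - x    ∎
    where open ≤-Reasoning

  -- The pattern of most inequalities below: the gap is written as a sum of terms known to be
  -- nonnegative, and the solver checks the identity. A known equation enters the sum as one of the
  -- two inequalities it implies.
  ≤-by-gap : 0# ≤ d → y ≈ x + d → x ≤ y
  ≤-by-gap {d} {y} {x} 0≤d y≈x+d = begin
    x       ≈⟨ +-identityʳ x ⟨
    x + 0#  ≤⟨ +-monoʳ-≤ x 0≤d ⟩
    x + d   ≈⟨ y≈x+d ⟨
    y       ∎
    where open ≤-Reasoning

  <-gap : x < y → 0# < y - x
  <-gap {x} {y} x<y = ≰⇒> λ y-x≤0 → <⇒≱ x<y
    (≤-by-gap (≤-gap y-x≤0) (solve 2 (λ x y → x := y :+ (:0 :- (y :- x))) refl x y))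

  <-by-gap : 0# < d → y ≈ x + d → x < y
  <-by-gap {d} {y} {x} 0<d y≈x+d = ≤-by-gap (<⇒≤ 0<d) y≈x+d , λ x≈y → <⇒≱ 0<d
    (≤-by-gap (≤-gap (≤-reflexive (trans (sym y≈x+d) (sym x≈y))))
      (solve 2 (λ x d → :0 := d :+ (x :- (x :+ d))) refl x d))

  +-nonNeg : 0# ≤ x → 0# ≤ y → 0# ≤ x + y
  +-nonNeg {x} {y} 0≤x 0≤y = ≤-trans 0≤x (≤-by-gap 0≤y refl)

  +-pos-nonNeg : 0# < x → 0# ≤ y → 0# < x + y
  +-pos-nonNeg {x} {y} 0<x 0≤y = <-≤-trans 0<x (≤-by-gap 0≤y refl)

  0≤1 : 0# ≤ 1#
  0≤1 with ≤-total 0# 1#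
  ... | inj₁ 0≤1 = 0≤1
  -- If `1# ≤ 0#`, then -1 is nonnegative, hence so is its square, which is 1.
  ... | inj₂ 1≤0 = ≤-by-gap (*-nonNeg (≤-gap 1≤0) (≤-gap 1≤0))
    (solve 0 (:1 := :0 :+ (:0 :- :1) :* (:0 :- :1)) refl)

  0<1 : 0# < 1#
  0<1 = 0≤1 , 0≉1

  positive-inverse : 0# < x → ∃[ y ] 0# < y × x * y ≈ 1#
  positive-inverse {x} 0<x with invertible (λ x≈0 → proj₂ 0<x (sym x≈0))
  ... | y , _ , xy≈1 = y , ≰⇒> y≰0 , xy≈1
    where
    y≰0 : ¬ y ≤ 0#
    -- For `y ≤ 0#` both `x (0 - y)` and `x y - 1` are nonnegative, yet they sum to -1.
    y≰0 y≤0 = <⇒≱ 0<1 (≤-by-gap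
      (+-nonNeg (*-nonNeg (<⇒≤ 0<x) (≤-gap y≤0)) (≤-gap (≤-reflexive (sym xy≈1))))
      (solve 2 (λ x y → :0 := :1 :+ (x :* (:0 :- y) :+ (x :* y :- :1))) refl x y))

  *-pos : 0# < x → 0# < y → 0# < x * y
  *-pos {x} {y} 0<x 0<y = let i , 0<i , xi≈1 = positive-inverse 0<x in
    *-nonNeg (<⇒≤ 0<x) (<⇒≤ 0<y) , λ 0≈xy → proj₂ 0<y (begin
    0#           ≈⟨ zeroˡ i ⟨
    0# * i       ≈⟨ *-congʳ 0≈xy ⟩
    x * y * i    ≈⟨ solve 3 (λ x y i → x :* y :* i := (x :* i) :* y) refl x y i ⟩
    x * i * y    ≈⟨ *-congʳ xi≈1 ⟩
    1# * y       ≈⟨ *-identityˡ y ⟩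
    y            ∎)
    where open SetoidReasoning setoid

  *-cancelˡ-≤ : 0# < t → t * x ≤ t * y → x ≤ y
  *-cancelˡ-≤ {t} {x} {y} 0<t tx≤ty = ≮⇒≥ λ y<x → <⇒≱
    (<-by-gap (*-pos 0<t (<-gap y<x)) (solve 3 (λ t x y → t :* x := t :* y :+ t :* (x :- y)) refl t x y))
    tx≤ty

  *-monoˡ-≤ : 0# ≤ t → x ≤ y → t * x ≤ t * y
  *-monoˡ-≤ {t} {x} {y} 0≤t x≤y = ≤-by-gap (*-nonNeg 0≤t (≤-gap x≤y))
    (solve 3 (λ t x y → t :* y := t :* x :+ t :* (y :- x)) refl t x y)

  -- The witness is `d / (1 + x)`, with `1 + x` because `x` may vanish; the gap left below `d` is
  -- the witness itself.
  small-multiple : 0# < d → 0# ≤ x → ∃[ ε ] 0# < ε × ε * x < d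
  small-multiple {d} {x} 0<d 0≤x =
    let i , 0<i , ⟨1+x⟩i≈1 = positive-inverse (+-pos-nonNeg 0<1 0≤x)
        0<di = *-pos 0<d 0<i
    in d * i , 0<di , <-by-gap 0<di (begin
    d                    ≈⟨ *-identityʳ d ⟨
    d * 1#               ≈⟨ *-congˡ ⟨1+x⟩i≈1 ⟨
    d * ((1# + x) * i)   ≈⟨ solve 3 (λ d x i → d :* ((:1 :+ x) :* i) := d :* i :* x :+ d :* i) refl d x i ⟩
    d * i * x + d * i    ∎)
    where open SetoidReasoning setoid

  positive-lower-bound : 0# < x → 0# < y → ∃[ z ] 0# < z × z ≤ x × z ≤ y
  positive-lower-bound {x} {y} 0<x 0<y with ≤-total x y
  ... | inj₁ x≤y = x , 0<x , ≤-refl , x≤y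
  ... | inj₂ y≤x = y , 0<y , y≤x , ≤-refl

  ∣x∣≤-lub : x ≤ y → - x ≤ y → ∣ x ∣ ≤ y
  ∣x∣≤-lub = ⊔-lub

  x≤∣x∣ : ∀ x → x ≤ ∣ x ∣
  x≤∣x∣ x = x≤x⊔y x (- x)

  -x≤∣x∣ : ∀ x → - x ≤ ∣ x ∣
  -x≤∣x∣ x = x≤y⊔x x (- x)

  -- A supremum argument: let `s` be the supremum of the `t ≤ r` with `Q l t`. The neighbourhood of
  -- `s` on which `Q` holds overlaps an interval already reached, and gluing carries `Q` past `s`.
  interval-induction : (Q : Carrier → Carrier → Set) →
    (∀ {a b c d} → a ≤ b → c ≤ d → Q a d → Q b c) →
    (∀ {a b c} → Q a b → Q b c → Q a c) →
    ∀ {l r} → l ≤ r →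
    (∀ t → l ≤ t → t ≤ r → ∃[ ε ] 0# < ε × Q (t - ε) (t + ε)) →
    Q l r
  interval-induction Q shrink glue {l} {r} l≤r local = Qlr
    where
    S : Pred Carrier 0ℓ
    S t = t ≤ r × Q l t

    Q-refl : ∀ t → l ≤ t → t ≤ r → Q t t
    Q-refl t l≤t t≤r = let ε , 0<ε , Qε = local t l≤t t≤r in shrink
      (≤-by-gap (<⇒≤ 0<ε) (solve 2 (λ t ε → t := t :- ε :+ ε) refl t ε))
      (≤-by-gap (<⇒≤ 0<ε) refl) Qε

    l∈S : l ∈ S
    l∈S = l≤r , Q-refl l ≤-refl l≤r

    sup : Satisfiable (LeastUpperBound S)
    sup = complete S (l , l∈S) (r , proj₁)

    s = proj₁ sup
    s-upper = proj₁ (proj₂ sup)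
    s-least = proj₂ (proj₂ sup)

    near-s : ∀ {ε} → 0# < ε → ∃[ t ] t ∈ S × s - ε < t
    near-s {ε} 0<ε = decidable-stable em λ ∄t →
      <⇒≱ (<-by-gap 0<ε (solve 2 (λ s ε → s := s :- ε :+ ε) refl s ε))
        (s-least λ {t} t∈S → ≮⇒≥ λ s-ε<t → ∄t (t , t∈S , s-ε<t))

    Qlr : Q l r
    Qlr =
      let ε , 0<ε , Qε = local s (s-upper l∈S) (s-least proj₁)
          t , (_ , Qlt) , s-ε<t = near-s 0<ε
          -- Otherwise `s + ε` would itself belong to `S` and exceed its supremum.
          r≤s+ε = decidable-stable em λ r≰s+ε → <⇒≱ (<-by-gap 0<ε refl)
            (s-upper (<⇒≤ (≰⇒> r≰s+ε) , glue Qlt (shrink (<⇒≤ s-ε<t) ≤-refl Qε)))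
      in glue Qlt (shrink (<⇒≤ s-ε<t) r≤s+ε Qε)

-- Compactness of boxes.

module Compactness (em : ExcludedMiddle 0ℓ) (ℝ : Reals) where

  open Reals ℝ hiding (zero)
  open IntegerSolver commutativeRing
  open OrderedField em ℝ

  Box : ∀ {n} → Carrier → Carrier → Pred (Vector Carrier n) 0ℓ
  Box l r x = ∀ i → l ≤ x i × x i ≤ r

  -- For `ε ≥ 0` this is the closed supremum-norm ball, kept coordinatewise so that it splits into a
  -- first coordinate and a tail.
  Cube : ∀ {n} → Vector Carrier n → Carrier → Pred (Vector Carrier n) 0ℓ
  Cube x ε y = ∀ i → x i - ε ≤ y i × y i ≤ x i + ε

  Cube-mono : ∀ {n} {x : Vector Carrier n} {δ ε} → δ ≤ ε → Cube x δ ⊆ Cube x ε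
  Cube-mono {x = x} {δ} {ε} δ≤ε {y} y∈ i =
    ≤-by-gap (+-nonNeg (≤-gap δ≤ε) (≤-gap (proj₁ (y∈ i))))
      (solve 4 (λ x y δ ε → y := x :- ε :+ ((ε :- δ) :+ (y :- (x :- δ)))) refl (x i) (y i) δ ε) ,
    ≤-trans (proj₂ (y∈ i)) (+-monoʳ-≤ (x i) δ≤ε)

  -- Heine-Borel without finite covers: the sets with a finite subcover form the
  -- typical 𝒩.
  box-compact : ∀ {n l r} → l ≤ r → (𝒩 : Pred (Pred (Vector Carrier n) 0ℓ) 0ℓ) →
    (∀ {A B} → A ⊆ B → 𝒩 B → 𝒩 A) →
    (∀ {A B} → 𝒩 A → 𝒩 B → 𝒩 (A ∪ B)) →
    (∀ x → Box l r x → ∃[ ε ] 0# < ε × 𝒩 (Cube x ε)) →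
    𝒩 (Box l r)
  box-compact {zero} {l} {r} l≤r 𝒩 hereditary ∪-closed local =
    -- In dimension zero any cube is the whole space, so one local instance suffices.
    hereditary (λ _ ()) (proj₂ (proj₂ (local (λ ()) λ ())))
  box-compact {suc n} {l} {r} l≤r 𝒩 hereditary ∪-closed local =
    hereditary (λ x∈ → x∈ zero , λ i → x∈ (suc i))
      -- Induction along the first coordinate: it remains to put a thin slab around each `t` into
      -- `𝒩`.
      (interval-induction (λ a b → 𝒩 (Slab a b (Box l r)))
        (λ a≤b c≤d → hereditary λ ((b≤x₀ , x₀≤c) , x∈) → (≤-trans a≤b b≤x₀ , ≤-trans x₀≤c c≤d) , x∈)
        (λ {a} {b} {c} 𝒩ab 𝒩bc → hereditary (λ {x} → split a b c (Box l r) {x}) (∪-closed 𝒩ab 𝒩bc))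
        l≤r slab)
    where
    Slab : Carrier → Carrier → Pred (Vector Carrier n) 0ℓ → Pred (Vector Carrier (suc n)) 0ℓ
    Slab a b A x = (a ≤ head x × head x ≤ b) × tail x ∈ A

    split : ∀ a b c A → Slab a c A ⊆ Slab a b A ∪ Slab b c A
    split a b c A {x} ((a≤x₀ , x₀≤c) , x∈) with ≤-total (head x) b
    ... | inj₁ x₀≤b = inj₁ ((a≤x₀ , x₀≤b) , x∈)
    ... | inj₂ b≤x₀ = inj₂ ((b≤x₀ , x₀≤c) , x∈)

    slab : ∀ t → l ≤ t → t ≤ r → ∃[ ε ] 0# < ε × 𝒩 (Slab (t - ε) (t + ε) (Box l r))
    slab t l≤t t≤r = box-compact l≤r 𝒩ₜ 𝒩ₜ-hereditary (λ {A} {B} → 𝒩ₜ-∪ {A} {B})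
      λ x x∈ → let ε , 0<ε , 𝒩x = local (t ∷ x) (λ { zero → l≤t , t≤r ; (suc i) → x∈ i }) in
        ε , 0<ε , ε , 0<ε , hereditary (λ (x₀∈ , x∈) → λ { zero → x₀∈ ; (suc i) → x∈ i }) 𝒩x
      where
      Near : Carrier → Pred (Vector Carrier n) 0ℓ → Pred (Vector Carrier (suc n)) 0ℓ
      Near ε = Slab (t - ε) (t + ε)

      -- As in the tube lemma, the compactness of the lower-dimensional box is applied to this
      -- family. The thickness is existential, so that a union can take the smaller of two.
      𝒩ₜ : Pred (Pred (Vector Carrier n) 0ℓ) 0ℓ
      𝒩ₜ A = ∃[ ε ] 0# < ε × 𝒩 (Near ε A)

      thinner : ∀ A {δ ε} → δ ≤ ε → Near δ A ⊆ Near ε A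
      -- The first coordinate is treated as a point of a one-dimensional cube.
      thinner A δ≤ε {x} (x₀∈ , x∈) =
        Cube-mono {x = λ (_ : Fin 1) → t} δ≤ε {λ _ → head x} (λ _ → x₀∈) zero , x∈

      𝒩ₜ-hereditary : ∀ {A B} → A ⊆ B → 𝒩ₜ B → 𝒩ₜ A
      𝒩ₜ-hereditary {A} {B} A⊆B (ε , 0<ε , 𝒩B) =
        ε , 0<ε , hereditary {Near ε A} {Near ε B} (λ (x₀∈ , x∈) → x₀∈ , A⊆B x∈) 𝒩B

      𝒩ₜ-∪ : ∀ {A B} → 𝒩ₜ A → 𝒩ₜ B → 𝒩ₜ (A ∪ B)
      𝒩ₜ-∪ {A} {B} (δ , 0<δ , 𝒩A) (ε , 0<ε , 𝒩B) =
        let ζ , 0<ζ , ζ≤δ , ζ≤ε = positive-lower-bound 0<δ 0<ε in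
        ζ , 0<ζ , hereditary {Near ζ (A ∪ B)} {Near δ A ∪ Near ε B}
          (λ { {x} (x₀∈ , inj₁ x∈A) → inj₁ (thinner A ζ≤δ {x} (x₀∈ , x∈A))
             ; {x} (x₀∈ , inj₂ x∈B) → inj₂ (thinner B ζ≤ε {x} (x₀∈ , x∈B)) })
          (∪-closed 𝒩A 𝒩B)

-- The supremum norm.

module SupremumNorm (em : ExcludedMiddle 0ℓ) (ℝ : Reals) where

  open Reals ℝ hiding (zero)
  open IntegerSolver commutativeRing
  open OrderedField em ℝ
  open Euclidean ℝ using (‖_‖)

  0≤‖x‖ : ∀ {n} (x : Vector Carrier n) → 0# ≤ ‖ n ‖ x
  0≤‖x‖ {zero}  x = ≤-refl
  0≤‖x‖ {suc n} x = ≤-trans (0≤‖x‖ (tail x)) (x≤y⊔x _ _)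

  ∣xᵢ∣≤‖x‖ : ∀ {n} (x : Vector Carrier n) i → ∣ x i ∣ ≤ ‖ n ‖ x
  ∣xᵢ∣≤‖x‖ x zero    = x≤x⊔y _ _
  ∣xᵢ∣≤‖x‖ x (suc i) = ≤-trans (∣xᵢ∣≤‖x‖ (tail x) i) (x≤y⊔x _ _)

  ‖x‖≤-lub : ∀ {n c} (x : Vector Carrier n) → 0# ≤ c → (∀ i → ∣ x i ∣ ≤ c) → ‖ n ‖ x ≤ c
  ‖x‖≤-lub {zero}  x 0≤c ∣xᵢ∣≤c = 0≤c
  ‖x‖≤-lub {suc n} x 0≤c ∣xᵢ∣≤c = ⊔-lub (∣xᵢ∣≤c zero) (‖x‖≤-lub (tail x) 0≤c (λ i → ∣xᵢ∣≤c (suc i)))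

-- Continuity, open sets and differentials.

module Calculus (em : ExcludedMiddle 0ℓ) (ℝ : Reals) (n : ℕ) where

  open Reals ℝ hiding (zero)
  open IntegerSolver commutativeRing
  open OrderedField em ℝ
  open Compactness em ℝ
  open SupremumNorm em ℝ
  open Euclidean ℝ n
  open LeftModuleMorphisms rawLeftModule (self {R = rawRing})

  module Linear (u' : E*) = IsLeftModuleHomomorphism (proj₂ u')

  ‖‖-resp-≈ : ∀ {x y : E} → (∀ i → x i ≈ y i) → ‖ x ‖ ≤ ‖ y ‖
  ‖‖-resp-≈ {x} {y} x≈y = ‖x‖≤-lub x (0≤‖x‖ y) λ i → ∣x∣≤-lub
    (≤-trans (≤-reflexive (x≈y i)) (≤-trans (x≤∣x∣ (y i)) (∣xᵢ∣≤‖x‖ y i)))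
    (≤-trans (≤-reflexive (-‿cong (x≈y i))) (≤-trans (-x≤∣x∣ (y i)) (∣xᵢ∣≤‖x‖ y i)))

  ‖tx‖≤t‖x‖ : ∀ {t} x → 0# ≤ t → ‖ t *ₗ x ‖ ≤ t * ‖ x ‖
  ‖tx‖≤t‖x‖ {t} x 0≤t = ‖x‖≤-lub (t *ₗ x) (*-nonNeg 0≤t (0≤‖x‖ x)) λ i → ∣x∣≤-lub
    (*-monoˡ-≤ 0≤t (≤-trans (x≤∣x∣ (x i)) (∣xᵢ∣≤‖x‖ x i)))
    (≤-trans (≤-reflexive (solve 2 (λ t x → :- (t :* x) := t :* (:- x)) refl t (x i)))
      (*-monoˡ-≤ 0≤t (≤-trans (-x≤∣x∣ (x i)) (∣xᵢ∣≤‖x‖ x i))))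

  small-scaling : ∀ (h : E) {δ} → 0# < δ → ∃[ τ ] 0# < τ × (∀ t → 0# < t → t ≤ τ → ‖ t *ₗ h ‖ < δ)
  small-scaling h {δ} 0<δ = let τ , 0<τ , τ‖h‖<δ = small-multiple 0<δ (0≤‖x‖ h) in
    τ , 0<τ , λ t 0<t t≤τ → ≤-<-trans
      (≤-trans (‖tx‖≤t‖x‖ h (<⇒≤ 0<t))
        (≤-by-gap (*-nonNeg (≤-gap t≤τ) (0≤‖x‖ h))
          (solve 3 (λ t τ m → τ :* m := t :* m :+ (τ :- t) :* m) refl t τ ‖ h ‖)))
      τ‖h‖<δ

  cube⊆ball : ∀ (x : E) {δ} → 0# < δ → ∃[ ε ] 0# < ε × (∀ {y} → Cube x ε y → ‖ y -ᴹ x ‖ < δ)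
  -- The cube is closed and the ball open, so the radius must be strictly below `δ`; a small
  -- multiple of 1 provides it.
  cube⊆ball x {δ} 0<δ = let ε , 0<ε , ε1<δ = small-multiple 0<δ 0≤1 in
    ε , 0<ε , λ {y} y∈ → ≤-<-trans
      (‖x‖≤-lub (y -ᴹ x) (*-nonNeg (<⇒≤ 0<ε) 0≤1) λ i → ∣x∣≤-lub
        (≤-by-gap (≤-gap (proj₂ (y∈ i)))
          (solve 3 (λ x y ε → ε :* :1 := (y :- x) :+ (x :+ ε :- y)) refl (x i) (y i) ε))
        (≤-by-gap (≤-gap (proj₁ (y∈ i)))
          (solve 3 (λ x y ε → ε :* :1 := (:- (y :- x)) :+ (y :- (x :- ε))) refl (x i) (y i) ε)))
      ε1<δ

  -- Without a maximum, each point of the box has a cube whose part in `K` stays strictly below one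
  -- value `φ y` with `y` in the box and in `K`. Such bounds survive unions, so compactness yields
  -- one for the whole box, and then `φ y < φ y`.
  extreme-value : ∀ {l r φ} {K : Pred E 0ℓ} → l ≤ r → Continuous φ →
    (∀ x → x ∉ K → ∃[ δ ] 0# < δ × (∀ y → ‖ y -ᴹ x ‖ < δ → y ∉ K)) →
    Satisfiable (Box l r ∩ K) →
    ∃[ x ] x ∈ Box l r ∩ K × (∀ y → y ∈ Box l r ∩ K → φ y ≤ φ x)
  extreme-value {l} {r} {φ} {K} l≤r continuous closed (z , z∈) = decidable-stable em λ ∄max →
    let y , (y∈Box , y∈K) , y-bounds = box-compact l≤r Bounded
          (λ A⊆B (y , y∈ , bounds) → y , y∈ , λ x∈A → bounds (A⊆B x∈A))
          (λ {A} {B} → Bounded-∪ {A} {B})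
          (locally-bounded ∄max)
    in <⇒≱ (y-bounds y∈Box y∈K) ≤-refl
    where
    Bounded : Pred (Pred E 0ℓ) 0ℓ
    Bounded A = ∃[ y ] y ∈ Box l r ∩ K × (∀ {x} → x ∈ A → x ∈ K → φ x < φ y)

    Bounded-∪ : ∀ {A B} → Bounded A → Bounded B → Bounded (A ∪ B)
    Bounded-∪ (y , y∈ , A<y) (w , w∈ , B<w) =
      [ (λ φy≤φw → w , w∈ , λ {x} → [ (λ x∈A x∈K → <-≤-trans (A<y x∈A x∈K) φy≤φw) , B<w ]′)
      , (λ φw≤φy → y , y∈ , λ {x} → [ A<y , (λ x∈B x∈K → <-≤-trans (B<w x∈B x∈K) φw≤φy) ]′)
      ]′ (≤-total (φ y) (φ w))

    NoMax : Set
    NoMax = ¬ (∃[ x ] x ∈ Box l r ∩ K × (∀ y → y ∈ Box l r ∩ K → φ y ≤ φ x))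

    larger : NoMax → ∀ x → x ∈ Box l r ∩ K → ∃[ y ] y ∈ Box l r ∩ K × φ x < φ y
    larger ∄max x x∈ = decidable-stable em λ ∄y →
      ∄max (x , x∈ , λ y y∈ → ≮⇒≥ λ φx<φy → ∄y (y , y∈ , φx<φy))

    locally-bounded : NoMax → ∀ x → Box l r x → ∃[ ε ] 0# < ε × Bounded (Cube x ε)
    locally-bounded ∄max x x∈Box = by-cases em
      where
      by-cases : Dec (x ∈ K) → ∃[ ε ] 0# < ε × Bounded (Cube x ε)
      by-cases (yes x∈K) =
        let y , y∈ , φx<φy    = larger ∄max x (x∈Box , x∈K)
            δ , 0<δ , near    = continuous x (φ y - φ x) (<-gap φx<φy)
            ε , 0<ε , in-ball = cube⊆ball x 0<δ
        in ε , 0<ε , y , y∈ , λ {w} w∈ _ →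
          let φw-φx<φy-φx = ≤-<-trans (x≤∣x∣ _) (near w (in-ball w∈)) in
          <-by-gap (<-gap φw-φx<φy-φx)
            (solve 3 (λ w x y → y := w :+ ((y :- x) :- (w :- x))) refl (φ w) (φ x) (φ y))
      by-cases (no x∉K) =
        let δ , 0<δ , away    = closed x x∉K
            ε , 0<ε , in-ball = cube⊆ball x 0<δ
        -- The cube misses `K`, so the bound is vacuous and any point of the box and `K` can witness
        -- it.
        in ε , 0<ε , z , z∈ , λ {w} w∈ w∈K → contradiction w∈K (away w (in-ball w∈))

  -- A bare function on setoid vectors need not respect equality. Continuity forces it to: equal
  -- vectors are at distance zero, hence within every `δ`.
  continuous⇒cong : ∀ {φ} → Continuous φ → ∀ {x y} → (∀ i → x i ≈ y i) → φ x ≈ φ y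
  continuous⇒cong {φ} continuous x≈y =
    ≤-antisym (φx≤φy x≈y) (φx≤φy (λ i → sym (x≈y i)))
    where
    φx≤φy : ∀ {x y} → (∀ i → x i ≈ y i) → φ x ≤ φ y
    φx≤φy {x} {y} x≈y = ≮⇒≥ λ φy<φx →
      let δ , 0<δ , near = continuous x (φ x - φ y) (<-gap φy<φx)
          y-x≈0 = λ i → trans (+-congʳ (sym (x≈y i))) (-‿inverseʳ (x i))
          ‖y-x‖<δ = ≤-<-trans
            (‖x‖≤-lub (y -ᴹ x) ≤-refl λ i → ∣x∣≤-lub (≤-reflexive (y-x≈0 i))
              (≤-reflexive (trans (-‿cong (y-x≈0 i)) (solve 0 (:- :0 := :0) refl))))
            0<δ
      in <⇒≱ (≤-<-trans (-x≤∣x∣ _) (near y ‖y-x‖<δ))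
           (≤-reflexive (solve 2 (λ x y → x :- y := :- (y :- x)) refl (φ x) (φ y)))

  open-translate : ∀ {U u} → Open U → u ∈ U → ∃[ δ ] 0# < δ × (∀ h → ‖ h ‖ < δ → u +ᴹ h ∈ U)
  open-translate {U} {u} U-open u∈U = let δ , 0<δ , ball⊆U = U-open u∈U in
    δ , 0<δ , λ h ‖h‖<δ → ball⊆U (u +ᴹ h) (≤-<-trans
      (‖‖-resp-≈ λ i → solve 2 (λ u h → u :+ h :- u := h) refl (u i) (h i)) ‖h‖<δ)

  open-ray : ∀ {U u} → Open U → u ∈ U → ∀ h →
    ∃[ τ ] 0# < τ × (∀ t → 0# < t → t ≤ τ → u +ᴹ t *ₗ h ∈ U)
  open-ray U-open u∈U h =
    let δ , 0<δ , translate = open-translate U-open u∈U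
        τ , 0<τ , small     = small-scaling h 0<δ
    in τ , 0<τ , λ t 0<t t≤τ → translate (t *ₗ h) (small t 0<t t≤τ)

  -- A one-sided difference quotient bounded by `c` bounds its limit. If `⟨ h , u' ⟩` exceeded `c`,
  -- the `ε` chosen with `ε ‖ h ‖` below the excess would contradict the approximation at a small
  -- `t`.
  derivative-≤ : ∀ {φ u u'} → IsDifferentialAt φ u u' → ∀ h c {τ} → 0# < τ →
    (∀ t → 0# < t → t ≤ τ → φ (u +ᴹ t *ₗ h) ≤ φ u + t * c) → ⟨ h , u' ⟩ ≤ c
  derivative-≤ {φ} {u} {u'} differential h c {τ} 0<τ φ-≤ = ≮⇒≥ λ c<h' →
    let h' = ⟨ h , u' ⟩
        ε , 0<ε , ε‖h‖<h'-c  = small-multiple (<-gap c<h') (0≤‖x‖ h)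
        δ , 0<δ , approx     = differential ε 0<ε
        σ , 0<σ , small      = small-scaling h 0<δ
        t , 0<t , t≤τ , t≤σ  = positive-lower-bound 0<τ 0<σ
        th = t *ₗ h
    in <⇒≱ ε‖h‖<h'-c (*-cancelˡ-≤ 0<t (≤-by-gap
      (+-nonNeg
        (+-nonNeg
          (*-nonNeg (<⇒≤ 0<ε) (≤-gap (‖tx‖≤t‖x‖ h (<⇒≤ 0<t))))
          (≤-gap (≤-trans (-x≤∣x∣ _) (approx th (small t 0<t t≤σ)))))
        (+-nonNeg
          (≤-gap (≤-reflexive (sym (Linear.*ₗ-homo u' t h))))
          (≤-gap (φ-≤ t 0<t t≤τ))))
      -- The four gaps are, in order, the scaling of the norm, the lower half of the differential
      -- estimate, the homogeneity of `u'`, and the assumed bound on `φ`.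
      (solve 9 (λ t ε ‖h‖ ‖th‖ h' th' c φu φu+th →
          t :* (ε :* ‖h‖) := t :* (h' :- c) :+
            ((ε :* (t :* ‖h‖ :- ‖th‖) :+ (ε :* ‖th‖ :- (:- (φu+th :- φu :- th')))) :+
             ((th' :- t :* h') :+ (φu :+ t :* c :- φu+th))))
        refl t ε ‖ h ‖ ‖ th ‖ h' ⟨ th , u' ⟩ c (φ u) (φ (u +ᴹ th)))))

-- The two inclusions for a concave homogeneous function on a cone.

module ConcaveOnCone (em : ExcludedMiddle 0ℓ) (ℝ : Reals) (n : ℕ)
  (U : Pred (Euclidean.E ℝ n) 0ℓ) (U-open : Euclidean.Open ℝ n U) (U-cone : Euclidean.Cone ℝ n U)
  (φ : Euclidean.E ℝ n → Reals.Carrier ℝ) (continuous : Euclidean.Continuous ℝ n φ)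
  (F : ∀ u → u ∈ U → Euclidean.E* ℝ n) (differential : Euclidean.IsDifferentialOn ℝ n U φ F)
  (concave : Euclidean.ConcaveOn ℝ n U φ) (homogeneous : Euclidean.PositivelyHomogeneous ℝ n φ)
  (positive : ∀ x → x ∈ U → Reals._<_ ℝ (Reals.0# ℝ) (φ x))
  (vanishes : ∀ x → x ∉ U → Reals._≈_ ℝ (φ x) (Reals.0# ℝ))
  where

  open Reals ℝ hiding (zero)
  open IntegerSolver commutativeRing
  open OrderedField em ℝ
  open Compactness em ℝ
  open SupremumNorm em ℝ
  open Calculus em ℝ n
  open Euclidean ℝ n
  open LeftModuleMorphisms rawLeftModule (self {R = rawRing})

  private variable u v : E

  -- `u + v` is the midpoint of `2u` and `2v`, where homogeneity doubles the values of `φ`;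
  -- concavity is used at `t = 1/2`.
  superadditive : u ∈ U → v ∈ U → φ u + φ v ≤ φ (u +ᴹ v)
  superadditive {u} {v} u∈U v∈U =
    let 0<2             = +-pos-nonNeg 0<1 0≤1
        i , 0<i , 2i≈1  = positive-inverse 0<2
        two             = 1# + 1#
        i≤1             = ≤-by-gap (<⇒≤ 0<i)
          (trans (sym 2i≈1) (solve 1 (λ i → (:1 :+ :1) :* i := i :+ i) refl i))
        midpoint : ∀ x y → (1# - i) * (two * x) + i * (two * y) ≈ x + y
        midpoint x y = begin
          (1# - i) * (two * x) + i * (two * y)
            -- The solver does not know that `i` is one half, so the factor `two * i - 1#` is
            -- isolated and then replaced by zero.
            ≈⟨ solve 3 (λ i x y → (:1 :- i) :* ((:1 :+ :1) :* x) :+ i :* ((:1 :+ :1) :* y) :=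
                 x :+ y :+ ((:1 :+ :1) :* i :- :1) :* (y :- x)) refl i x y ⟩
          x + y + (two * i - 1#) * (y - x)
            ≈⟨ +-congˡ (*-congʳ (trans (+-congʳ 2i≈1) (-‿inverseʳ 1#))) ⟩
          x + y + 0# * (y - x)
            ≈⟨ trans (+-congˡ (zeroˡ _)) (+-identityʳ _) ⟩
          x + y ∎
    in ≤-trans
      (≤-reflexive (sym (trans
        (+-cong (*-congˡ (homogeneous two 0<2 u)) (*-congˡ (homogeneous two 0<2 v)))
        (midpoint (φ u) (φ v)))))
      (≤-trans
        (concave (U-cone u∈U two 0<2) (U-cone v∈U two 0<2) i (<⇒≤ 0<i) i≤1)
        (≤-reflexive (continuous⇒cong continuous λ j → midpoint (u j) (v j))))
    where open SetoidReasoning setoid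

  φ≤differential : (u∈U : u ∈ U) → v ∈ U → φ v ≤ ⟨ v , F u u∈U ⟩
  φ≤differential {u} {v} u∈U v∈U =
    let Fu = F u u∈U
        τ , 0<τ , ray = open-ray U-open u∈U (-ᴹ v)
        -- The direction is `-v` because `derivative-≤` asks for upper bounds, and superadditivity
        -- of `u - t v` and `t v` bounds `φ (u - t v)` from above.
        F[-v]≤-φv = derivative-≤ {φ} {u} {Fu} (differential u u∈U) (-ᴹ v) (- φ v) 0<τ λ t 0<t t≤τ →
          ≤-by-gap (≤-gap (≤-trans
              (superadditive (ray t 0<t t≤τ) (U-cone v∈U t 0<t))
              (≤-reflexive (continuous⇒cong continuous λ i →
                solve 3 (λ u v t → u :+ t :* (:- v) :+ t :* v := u) refl (u i) (v i) t))))
            (trans (solve 5 (λ t u v tv w → u :+ t :* (:- v) := w :+ (u :- (w :+ tv)) :+ (tv :- t :* v)) refl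
                t (φ u) (φ v) (φ (t *ₗ v)) (φ (u +ᴹ t *ₗ (-ᴹ v))))
              (trans (+-congˡ (trans (+-congʳ (homogeneous t 0<t v)) (-‿inverseʳ _))) (+-identityʳ _)))
    in ≤-by-gap (≤-gap F[-v]≤-φv)
         (trans (solve 2 (λ p q → q := p :+ (:- p :- :- q)) refl (φ v) ⟨ v , Fu ⟩)
           (+-congˡ (+-congˡ (-‿cong (sym (Linear.-ᴹ-homo Fu v))))))

  -- Since `0 < φ v ≤ ⟨ v , F u ⟩`, a factor `r ≥ 1` can only increase the right-hand side.
  ℝ≥1-image⊆C₁ : (ℝ≥1 (Image U F)) ⊆ C₁ U φ
  ℝ≥1-image⊆C₁ {u'} (r , w' , 1≤r , (u , u∈U , w'≈Fu) , u'≈rw') v v∈U =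
    let Fuv = ⟨ v , F u u∈U ⟩
        φv≤Fuv = φ≤differential u∈U v∈U
    in ≤-trans
      (≤-by-gap (+-nonNeg (≤-gap φv≤Fuv)
          (*-nonNeg (≤-gap 1≤r) (≤-trans (<⇒≤ (positive v v∈U)) φv≤Fuv)))
        (solve 3 (λ r p q → r :* q := p :+ ((q :- p) :+ (r :- :1) :* q)) refl r (φ v) Fuv))
      (≤-reflexive (sym (trans (u'≈rw' v) (*-congˡ (w'≈Fu v)))))

  -- Interior points of `C₁`: bounded slices and the maximiser.

  add-coordinate : E* → Carrier → Fin n → E*
  add-coordinate u' c i = (λ x → ⟨ x , u' ⟩ + c * x i) , record
    { +ᴹ-isGroupHomomorphism = record
      { isMonoidHomomorphism = record
        { isMagmaHomomorphism = record
          { isRelHomomorphism = record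
            { cong = λ x≈y → +-cong (Linear.⟦⟧-cong u' x≈y) (*-congˡ (x≈y i)) }
          ; homo = λ x y → trans (+-congʳ (Linear.+ᴹ-homo u' x y))
              (solve 5 (λ p q c a b → p :+ q :+ c :* (a :+ b) := p :+ c :* a :+ (q :+ c :* b)) refl
                ⟨ x , u' ⟩ ⟨ y , u' ⟩ c (x i) (y i))
          }
        ; ε-homo = trans (+-cong (Linear.0ᴹ-homo u') (zeroʳ c)) (+-identityʳ 0#)
        }
      ; ⁻¹-homo = λ x → trans (+-congʳ (Linear.-ᴹ-homo u' x))
          (solve 3 (λ p c a → :- p :+ c :* (:- a) := :- (p :+ c :* a)) refl ⟨ x , u' ⟩ c (x i))
      }
    ; *ₗ-homo = λ r x → trans (+-congʳ (Linear.*ₗ-homo u' r x))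
        (solve 4 (λ r p c a → r :* p :+ c :* (r :* a) := r :* (p :+ c :* a)) refl r ⟨ x , u' ⟩ c (x i))
    }

  within-add-coordinate : ∀ {δ} u' c i →
    (∀ x → c * x i ≤ δ * ‖ x ‖) → (∀ x → - (c * x i) ≤ δ * ‖ x ‖) →
    Within δ (add-coordinate u' c i) u'
  within-add-coordinate u' c i cxᵢ≤ -cxᵢ≤ x = ∣x∣≤-lub
    (≤-trans (≤-reflexive cancel) (cxᵢ≤ x))
    (≤-trans (≤-reflexive (-‿cong cancel)) (-cxᵢ≤ x))
    where cancel = solve 2 (λ p q → p :+ q :- p := q) refl ⟨ x , u' ⟩ (c * x i)

  module Interior (u' : E*) (δ : Carrier) (0<δ : 0# < δ)
    (near-u' : ∀ v' → Within δ v' u' → v' ∈ C₁ U φ) where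

    open Linear u' using (+ᴹ-homo; *ₗ-homo; -ᴹ-homo)

    ℓ : E → Carrier
    ℓ x = ⟨ x , u' ⟩

    u'∈C₁ : u' ∈ C₁ U φ
    u'∈C₁ = near-u' u' λ x →
      let 0≤δ‖x‖ = *-nonNeg (<⇒≤ 0<δ) (0≤‖x‖ x) in ∣x∣≤-lub
        (≤-trans (≤-reflexive (-‿inverseʳ (ℓ x))) 0≤δ‖x‖)
        (≤-trans (≤-reflexive (solve 1 (λ a → :- (a :- a) := :0) refl (ℓ x))) 0≤δ‖x‖)

    ℓ-positive : u ∈ U → 0# < ℓ u
    ℓ-positive {u} u∈U = <-≤-trans (positive u u∈U) (u'∈C₁ u u∈U)

    -- The first bound comes from testing `C₁` at `u' - δ eᵢ*`, where `0 < φ u ≤ ℓ u - δ uᵢ`; the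
    -- second from the opposite sign.
    coordinate-bounds : u ∈ U → ∀ i → δ * u i ≤ ℓ u × - (δ * u i) ≤ ℓ u
    coordinate-bounds {u} u∈U i =
      ≤-by-gap (≤-trans (<⇒≤ (positive u u∈U)) (near-u' (add-coordinate u' (- δ) i)
          (within-add-coordinate u' (- δ) i
            (λ x → ≤-trans (≤-reflexive (neg x)) (lower x))
            (λ x → ≤-trans (≤-reflexive (neg-neg x)) (upper x))) u u∈U))
        (solve 3 (λ p δ a → p := δ :* a :+ (p :+ (:- δ) :* a)) refl (ℓ u) δ (u i)) ,
      ≤-by-gap (≤-trans (<⇒≤ (positive u u∈U)) (near-u' (add-coordinate u' δ i)
          (within-add-coordinate u' δ i upper lower) u u∈U))
        (solve 3 (λ p δ a → p := :- (δ :* a) :+ (p :+ δ :* a)) refl (ℓ u) δ (u i))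
      where
      neg : ∀ (x : E) → - δ * x i ≈ - (δ * x i)
      neg x = solve 2 (λ δ a → (:- δ) :* a := :- (δ :* a)) refl δ (x i)

      neg-neg : ∀ (x : E) → - (- δ * x i) ≈ δ * x i
      neg-neg x = solve 2 (λ δ a → :- ((:- δ) :* a) := δ :* a) refl δ (x i)

      upper : ∀ x → δ * x i ≤ δ * ‖ x ‖
      upper x = *-monoˡ-≤ (<⇒≤ 0<δ) (≤-trans (x≤∣x∣ (x i)) (∣xᵢ∣≤‖x‖ x i))

      lower : ∀ x → - (δ * x i) ≤ δ * ‖ x ‖
      lower x = ≤-trans (≤-reflexive (solve 2 (λ δ a → :- (δ :* a) := δ :* (:- a)) refl δ (x i)))
        (*-monoˡ-≤ (<⇒≤ 0<δ) (≤-trans (-x≤∣x∣ (x i)) (∣xᵢ∣≤‖x‖ x i)))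

    HalfSpace : Pred E 0ℓ
    HalfSpace x = ℓ x ≤ 1#

    -- ℓ ≥ 0 on a ball about u ∈ U, so ℓ h ≥ - s ℓ u for all small h.
    halfSpace-closed : u ∈ U → ∀ x → x ∉ HalfSpace →
      ∃[ ε ] 0# < ε × (∀ y → ‖ y -ᴹ x ‖ < ε → y ∉ HalfSpace)
    halfSpace-closed {u} u∈U x x∉ =
      let 1<ℓx                    = ≰⇒> x∉
          ρ , 0<ρ , translate     = open-translate U-open u∈U
          -- `s` keeps the possible drop `s ℓ u` below the excess `ℓ x - 1`, and its inverse `i`
          -- stretches `y - x` to a vector shorter than `ρ`, so that `ℓ (u + i (y - x))` is still
          -- positive.
          s , 0<s , sℓu<ℓx-1      = small-multiple (<-gap 1<ℓx) (<⇒≤ (ℓ-positive u∈U))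
          i , 0<i , si≈1          = positive-inverse 0<s
      in s * ρ , *-pos 0<s 0<ρ , λ y ‖y-x‖<sρ →
        let h = y -ᴹ x
            ‖ih‖<ρ = ≤-<-trans (‖tx‖≤t‖x‖ h (<⇒≤ 0<i)) (≰⇒> λ ρ≤i‖h‖ → <⇒≱ ‖y-x‖<sρ
              (≤-trans (*-monoˡ-≤ (<⇒≤ 0<s) ρ≤i‖h‖)
                (≤-reflexive (trans (sym (*-assoc s i ‖ h ‖)) (trans (*-congʳ si≈1) (*-identityˡ _))))))
            0<ℓ[u+ih] = ℓ-positive (translate (i *ₗ h) ‖ih‖<ρ)
            ℓ[u+ih]≈ = trans (+ᴹ-homo u (i *ₗ h)) (+-congˡ (trans (*ₗ-homo i h)
              (*-congˡ (trans (+ᴹ-homo y (-ᴹ x)) (+-congˡ (-ᴹ-homo x))))))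
            sℓ[u+ih]≈ = begin
              s * ℓ (u +ᴹ i *ₗ h)                ≈⟨ *-congˡ ℓ[u+ih]≈ ⟩
              s * (ℓ u + i * (ℓ y - ℓ x))        ≈⟨ solve 4 (λ s u i d → s :* (u :+ i :* d) := s :* u :+ (s :* i) :* d)
                                                      refl s (ℓ u) i (ℓ y - ℓ x) ⟩
              s * ℓ u + (s * i) * (ℓ y - ℓ x)    ≈⟨ +-congˡ (trans (*-congʳ si≈1) (*-identityˡ _)) ⟩
              s * ℓ u + (ℓ y - ℓ x)              ∎
        in <⇒≱ (<-by-gap
          (+-pos-nonNeg (<-gap sℓu<ℓx-1) (≤-trans (*-nonNeg (<⇒≤ 0<s) (<⇒≤ 0<ℓ[u+ih])) (≤-reflexive sℓ[u+ih]≈)))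
          (solve 3 (λ su y x → y := :1 :+ ((x :- :1 :- su) :+ (su :+ (y :- x)))) refl (s * ℓ u) (ℓ y) (ℓ x)))
      where open SetoidReasoning setoid

    -- The half-side `1 / δ` of the box: on the slice, `δ ∣uᵢ∣ ≤ ℓ u ≤ 1`.
    R : Carrier
    R = proj₁ (positive-inverse 0<δ)

    0<R : 0# < R
    0<R = proj₁ (proj₂ (positive-inverse 0<δ))

    δR≈1 : δ * R ≈ 1#
    δR≈1 = proj₂ (proj₂ (positive-inverse 0<δ))

    -- `K` is not cut down to `U`, as the open set `U` could spoil closedness; the extra points have
    -- `φ = 0` and cannot be maximisers.
    K : Pred E 0ℓ
    K = Box (- R) R ∩ HalfSpace

    U∩halfSpace⊆K : u ∈ U → u ∈ HalfSpace → u ∈ K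
    U∩halfSpace⊆K {u} u∈U ℓu≤1 = (λ i →
      let δuᵢ≤ℓu , -δuᵢ≤ℓu = coordinate-bounds u∈U i
          ℓu≤δR = ≤-trans ℓu≤1 (≤-reflexive (sym δR≈1))
      in *-cancelˡ-≤ 0<δ (≤-by-gap (≤-gap (≤-trans -δuᵢ≤ℓu ℓu≤δR))
           (solve 3 (λ δ R a → δ :* a := δ :* (:- R) :+ (δ :* R :- :- (δ :* a))) refl δ R (u i))) ,
         *-cancelˡ-≤ 0<δ (≤-trans δuᵢ≤ℓu ℓu≤δR)) ,
      ℓu≤1

    -- Every ray of `U` meets `K` at the level `ℓ = 1`. By homogeneity, this carries estimates on
    -- `K` over to all of `U`.
    normalise : u ∈ U → ∃[ α ] 0# < α × α * ℓ u ≈ 1# × α *ₗ u ∈ K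
    normalise {u} u∈U =
      let α , 0<α , ℓuα≈1 = positive-inverse (ℓ-positive u∈U)
          αℓu≈1 = trans (*-comm α (ℓ u)) ℓuα≈1
      in α , 0<α , αℓu≈1 , U∩halfSpace⊆K (U-cone u∈U α 0<α) (≤-reflexive (trans (*ₗ-homo α u) αℓu≈1))

    module Maximiser (x : E) (x∈K : x ∈ K) (maximal : ∀ y → y ∈ K → φ y ≤ φ x)
      (u₀∈U : Satisfiable U) where

      φx>0 : 0# < φ x
      φx>0 = let u₀ , u₀∈U = u₀∈U
                 α , 0<α , _ , αu₀∈K = normalise u₀∈U
             in <-≤-trans (positive (α *ₗ u₀) (U-cone u₀∈U α 0<α)) (maximal (α *ₗ u₀) αu₀∈K)

      x∈U : x ∈ U
      x∈U = decidable-stable em λ x∉U → proj₂ φx>0 (sym (vanishes x x∉U))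

      φx≤1 : φ x ≤ 1#
      φx≤1 = ≤-trans (u'∈C₁ x x∈U) (proj₂ x∈K)

      φ≤φxℓ : u ∈ U → φ u ≤ φ x * ℓ u
      φ≤φxℓ {u} u∈U =
        let α , 0<α , αℓu≈1 , αu∈K = normalise u∈U in
        *-cancelˡ-≤ 0<α (begin
          α * φ u            ≈⟨ homogeneous α 0<α u ⟨
          φ (α *ₗ u)         ≤⟨ maximal (α *ₗ u) αu∈K ⟩
          φ x                ≈⟨ *-identityʳ _ ⟨
          φ x * 1#           ≈⟨ *-congˡ αℓu≈1 ⟨
          φ x * (α * ℓ u)    ≈⟨ solve 3 (λ p a l → p :* (a :* l) := a :* (p :* l)) refl (φ x) α (ℓ u) ⟩
          α * (φ x * ℓ u)    ∎)
        where open ≤-Reasoning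

      Fx : E*
      Fx = F x x∈U

      -- Near `x` the function `φ` lies below the linear function `φ x * ℓ`, whose value at `x` is
      -- at most `φ x`; the bound passes to the derivative.
      Fx≤φxℓ : ∀ h → ⟨ h , Fx ⟩ ≤ φ x * ℓ h
      Fx≤φxℓ h = let τ , 0<τ , ray = open-ray U-open x∈U h in
        derivative-≤ {φ} {x} {Fx} (differential x x∈U) h (φ x * ℓ h) 0<τ λ t 0<t t≤τ → begin
          φ (x +ᴹ t *ₗ h)                  ≤⟨ φ≤φxℓ (ray t 0<t t≤τ) ⟩
          φ x * ℓ (x +ᴹ t *ₗ h)            ≈⟨ *-congˡ (trans (+ᴹ-homo x (t *ₗ h)) (+-congˡ (*ₗ-homo t h))) ⟩
          -- Only `ℓ x ≤ 1#` is known from `x ∈ K`; with `φ x > 0` this is the direction required.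
          φ x * (ℓ x + t * ℓ h)            ≤⟨ ≤-by-gap (*-nonNeg (<⇒≤ φx>0) (≤-gap (proj₂ x∈K)))
                                                (solve 4 (λ p x t h → p :+ t :* (p :* h) := p :* (x :+ t :* h) :+ p :* (:1 :- x))
                                                  refl (φ x) (ℓ x) t (ℓ h)) ⟩
          φ x + t * (φ x * ℓ h)            ∎
        where open ≤-Reasoning

      -- Both sides are linear in `h`, so the inequality at `-h` reverses the one at `h`.
      Fx≈φxℓ : ∀ h → ⟨ h , Fx ⟩ ≈ φ x * ℓ h
      Fx≈φxℓ h = ≤-antisym (Fx≤φxℓ h) (≤-by-gap (≤-gap (Fx≤φxℓ (-ᴹ h))) (begin
        ⟨ h , Fx ⟩                                          ≈⟨ solve 3 (λ p l f → f := p :* l :+ (p :* (:- l) :- :- f))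
                                                                 refl (φ x) (ℓ h) ⟨ h , Fx ⟩ ⟩
        φ x * ℓ h + (φ x * - ℓ h - - ⟨ h , Fx ⟩)            ≈⟨ +-congˡ (+-cong (*-congˡ (-ᴹ-homo h)) (-‿cong (Linear.-ᴹ-homo Fx h))) ⟨
        φ x * ℓ h + (φ x * ℓ (-ᴹ h) - ⟨ -ᴹ h , Fx ⟩)        ∎))
        where open SetoidReasoning setoid

      u'∈ℝ≥1-image : u' ∈ (ℝ≥1 (Image U F))
      u'∈ℝ≥1-image =
        let r , 0<r , φxr≈1 = positive-inverse φx>0
        in r , Fx ,
          -- `1 ≤ r` because `φ x * 1 ≤ 1 = φ x * r`.
          *-cancelˡ-≤ φx>0 (≤-trans (≤-reflexive (*-identityʳ _)) (≤-trans φx≤1 (≤-reflexive (sym φxr≈1)))) ,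
          (x , x∈U , λ _ → refl) ,
          λ h → sym (begin
            r * ⟨ h , Fx ⟩     ≈⟨ *-congˡ (Fx≈φxℓ h) ⟩
            r * (φ x * ℓ h)    ≈⟨ solve 3 (λ r p l → r :* (p :* l) := (p :* r) :* l) refl r (φ x) (ℓ h) ⟩
            φ x * r * ℓ h      ≈⟨ trans (*-congʳ φxr≈1) (*-identityˡ _) ⟩
            ℓ h                ∎)
        where open SetoidReasoning setoid

  interior⊆ℝ≥1-image : Satisfiable U → Interior* (C₁ U φ) ⊆ (ℝ≥1 (Image U F))
  interior⊆ℝ≥1-image (u₀ , u₀∈U) {u'} (δ , 0<δ , near-u') =
    let open Interior u' δ 0<δ near-u'
        α , _ , _ , αu₀∈K = normalise u₀∈U
        -R≤R = ≤-by-gap (+-nonNeg (<⇒≤ 0<R) (<⇒≤ 0<R))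
          (solve 1 (λ R → R := :- R :+ (R :+ R)) refl R)
        -- `u₀` is the reference point for closedness of the half-space, and its normalisation shows
        -- that `K` is inhabited.
        x , x∈K , maximal = extreme-value -R≤R continuous (halfSpace-closed u₀∈U) (α *ₗ u₀ , αu₀∈K)
    in Maximiser.u'∈ℝ≥1-image x x∈K maximal (u₀ , u₀∈U)

theorem5p2 : ExcludedMiddle 0ℓ →
    (ℝ : Reals) (n : ℕ) →
    let open Reals ℝ
        open Euclidean ℝ n
    in
    (U : Pred E 0ℓ) → Satisfiable U → Open U → Convex U → Cone U →
    (φ : E → Carrier) → Continuous φ →
    (F : ∀ u → u ∈ U → E*) → IsDifferentialOn U φ F →
    ConcaveOn U φ →
    PositivelyHomogeneous φ →
    (∀ x → x ∈ U → 0# < φ x) →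
    (∀ x → x ∉ U → φ x ≈ 0#) →
    (Interior* (C₁ U φ) ⊆ (ℝ≥1 (Image U F))) × ((ℝ≥1 (Image U F)) ⊆ C₁ U φ)
theorem5p2 em ℝ n U nonempty U-open _ U-cone φ continuous F differential concave homogeneous positive vanishes =
  (λ {u'} → interior⊆ℝ≥1-image nonempty {u'}) , (λ {u'} → ℝ≥1-image⊆C₁ {u'})
  where
  open ConcaveOnCone em ℝ n U U-open U-cone φ continuous F differential
    concave homogeneous positive vanishes
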